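{- Let $G$ be a finite simple outerplanar graph of maximum degree $\Delta \geq 5$. Then $\mathrm{ind}(G^2) \leq \Delta + 1$. If moreover $\Delta \geq 7$, then $\mathrm{ind}(G^2) = \Delta$.
   Context: For a graph $G$, the square $G^2$ is the graph on $V(G)$ in which two distinct vertices are adjacent iff their distance in $G$ is 1 or 2. The inductiveness (degeneracy) of a graph $H$ is $\mathrm{ind}(H) = \max\{\delta(H') : H' \text{ an induced subgraph of } H\}$, where $\delta$ denotes minimum degree. -}

module Defs where

open import Data.Nat using (ℕ; zero; suc; _⊓_; _⊔_)
open import Data.Bool using (Bool; true; false; _∧_; _∨_; not; if_then_else_)
open import Data.Fin using (Fin; toℕ; _<_) renaming (zero to fzero; suc to fsuc)
import Data.Fin as F
open import Data.List using (List; []; _∷_; map; allFin; filter; concatMap; foldr)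
open import Data.Nat.ListAction using (sum)
open import Data.Bool.ListAction using (any)
open import Data.Product using (_×_)
open import Relation.Nullary using (¬_; does)
open import Relation.Binary.PropositionalEquality using (_≡_)
open import Function.Definitions using (Injective)

record Graph (n : ℕ) : Set where
  field
    adj    : Fin n → Fin n → Bool
    sym    : ∀ u v → adj u v ≡ adj v u
    irrefl : ∀ v → adj v v ≡ false
open Graph public

Rel : ℕ → Set
Rel n = Fin n → Fin n → Bool

indicator : Bool → ℕ
indicator b = if b then 1 else 0

degR : ∀ {n} → Rel n → Fin n → ℕ
degR {n} A v = sum (map (λ u → indicator (A v u)) (allFin n))

deg : ∀ {n} → Graph n → Fin n → ℕ
deg G v = degR (adj G) v

HasMaxDegree : ∀ {n} → Graph n → ℕ → Set
HasMaxDegree {n} G Δ = (∀ v → deg G v Data.Nat.≤ Δ) × Data.Product.∃ (λ v → deg G v ≡ Δ)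
  where import Data.Nat
        import Data.Product

square : ∀ {n} → Graph n → Rel n
square {n} G u v =
  not (does (u F.≟ v)) ∧ (adj G u v ∨ any (λ w → adj G u w ∧ adj G w v) (allFin n))

Subset : ℕ → Set
Subset n = Fin n → Bool

extend : ∀ {n} → Bool → Subset n → Subset (suc n)
extend b S fzero = b
extend b S (fsuc i) = S i

allSubsets : ∀ n → List (Subset n)
allSubsets zero = (λ ()) ∷ []
allSubsets (suc n) = concatMap (λ S → extend false S ∷ extend true S ∷ []) (allSubsets n)

degIn : ∀ {n} → Rel n → Subset n → Fin n → ℕ
degIn {n} A S v = sum (map (λ u → indicator (S u ∧ A v u)) (allFin n))

members : ∀ {n} → Subset n → List (Fin n)
members {n} S = filter (λ v → Data.Bool.T? (S v)) (allFin n)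
  where import Data.Bool

minList : List ℕ → ℕ
minList [] = 0
minList (x ∷ []) = x
minList (x ∷ y ∷ xs) = x ⊓ minList (y ∷ xs)

-- minimum degree δ(H[S]) (convention: 0 for the empty subgraph,
-- which never affects the maximum below)
minDegIn : ∀ {n} → Rel n → Subset n → ℕ
minDegIn A S = minList (map (degIn A S) (members S))

ind : ∀ {n} → Rel n → ℕ
ind {n} A = foldr _⊔_ 0 (map (minDegIn A) (allSubsets n))

-- Outerplanar: the vertices can be placed in (bijective) cyclic order on a
-- circle, via an injective position map p : Fin n → Fin n, so that the edges,
-- drawn as chords, do not cross.
Outerplanar : ∀ {n} → Graph n → Set
Outerplanar {n} G =
  Data.Product.∃ λ (p : Fin n → Fin n) →
    Injective _≡_ _≡_ p ×
    (∀ a b c d → adj G a b ≡ true → adj G c d ≡ true →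
       ¬ (p a < p c × p c < p b × p b < p d))
  where import Data.Product

{-# OPTIONS --safe #-}
module Submission where

-- It suffices to find, in every outerplanar graph of maximum degree at most Δ, a vertex v with at
-- most two neighbours and at most K neighbours in the square (K = Δ + 1, or K = Δ ≥ 7). Indeed, if v
-- lies in the given vertex set S we are done, and otherwise v can be deleted and its two neighbours
-- joined: degrees do not grow, the graph stays outerplanar, and the square induced on S only grows.
--
-- Such a v is found by induction on the chords ab of the outerplanar drawing. Walk along the
-- face below ab, starting at a, for at most four steps. By induction each side of the face cuts
-- off nothing, a single vertex of degree 2 (an "ear"), or one of finitely many "heavy"
-- configurations, which yield v as soon as one of their two ends has small degree. Vertices of the
-- face other than a and b have small degree, so only ears and bare sides remain; then either v is
-- found or the face is a triangle or a quadrilateral, and what ab cuts off is again of the listed kinds.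
-- Consecutive vertices of the drawing count as a side of a face even when they are not adjacent,
-- which avoids any reduction to the 2-connected case.

open import Defs
open import Data.Nat using (ℕ; zero; suc; _+_; _⊔_; _≤_; _<_; z≤n; s≤s)
open import Data.Nat.Properties hiding (_≟_)
import Data.Bool as Bool
open import Data.Bool using (Bool; true; false; _∧_; _∨_; not; T?)
open import Data.Bool.Properties using (T-≡; ∨-zeroʳ)
open import Data.Fin using (Fin; toℕ; _≟_) renaming (zero to fzero; suc to fsuc)
open import Data.Fin.Properties using (toℕ-injective; any?)
open import Data.List using (List; []; _∷_; _++_; map; length; allFin; foldr)
open import Data.List.Properties using (map-tabulate; map-cong; length-++; ++-identityʳ)
open import Data.List.Membership.Propositional using (_∈_; lose)
open import Data.List.Membership.Propositional.Properties using (∈-allFin; ∈-map⁺; ∈-filter⁺; ∈-filter⁻; ∈-concatMap⁺; ∈-++⁺ˡ; ∈-++⁺ʳ; ∈-++⁻)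
open import Data.List.Relation.Unary.All as All using (All; []; _∷_)
open import Data.List.Relation.Unary.All.Properties using (++⁺; map⁺)
open import Data.List.Relation.Unary.Any using (here; there; satisfied)
open import Data.List.Relation.Unary.Any.Properties using (any⁺; any⁻)
open import Data.Nat.ListAction using (sum)
open import Algebra.Properties.CommutativeSemigroup +-commutativeSemigroup using (interchange)
open import Relation.Binary.Definitions using (Tri; tri<; tri≈; tri>)
open import Data.Product using (_×_; _,_; ∃; proj₁; proj₂)
open import Data.Sum as Sum using (_⊎_; inj₁; inj₂; [_,_]′)
open import Data.Empty using (⊥-elim)
open import Function using (_∘_; id)
open import Function.Bundles using (Equivalence; mk⇔)
open import Relation.Nullary using (¬_; Dec; yes; no; does; contradiction)
open import Relation.Nullary.Decidable using (does-⇔; dec-true; dec-false; _×-dec_; _⊎-dec_; ¬?)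
open import Relation.Binary.PropositionalEquality using (_≡_; _≢_; refl; trans; cong; cong₂; subst) renaming (sym to ≡-sym)

-- Counting

count : ∀ {n} → Subset n → ℕ
count {n} S = sum (map (λ u → indicator (S u)) (allFin n))

_─_ : ∀ {n} → Subset n → Fin n → Subset n
(S ─ v) u = S u ∧ not (does (u ≟ v))

sum-map-mono : ∀ {A : Set} {f g : A → ℕ} → (∀ x → f x ≤ g x) → ∀ xs → sum (map f xs) ≤ sum (map g xs)
sum-map-mono f≤g []       = z≤n
sum-map-mono f≤g (x ∷ xs) = +-mono-≤ (f≤g x) (sum-map-mono f≤g xs)

sum-map-+ : ∀ {A : Set} (f g : A → ℕ) xs → sum (map (λ x → f x + g x) xs) ≡ sum (map f xs) + sum (map g xs)
sum-map-+ f g []       = refl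
sum-map-+ f g (x ∷ xs) = trans (cong (f x + g x +_) (sum-map-+ f g xs))
                               (interchange (f x) (g x) (sum (map f xs)) (sum (map g xs)))

count-cong : ∀ {n} {S S′ : Subset n} → (∀ u → S u ≡ S′ u) → count S ≡ count S′
count-cong {n} S≗S′ = cong sum (map-cong (λ u → cong indicator (S≗S′ u)) (allFin n))

count-mono : ∀ {n} {S S′ : Subset n} → (∀ u → S u ≡ true → S′ u ≡ true) → count S ≤ count S′
count-mono {n} {S} {S′} S⊆S′ = sum-map-mono pointwise (allFin n)
  where
  pointwise : ∀ u → indicator (S u) ≤ indicator (S′ u)
  pointwise u with S u in eq
  ... | false = z≤n
  ... | true rewrite S⊆S′ u eq = ≤-refl

count-∨ : ∀ {n} (S S′ : Subset n) → count (λ u → S u ∨ S′ u) ≤ count S + count S′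
count-∨ {n} S S′ = ≤-trans (sum-map-mono (λ u → pointwise (S u) (S′ u)) (allFin n))
                           (≤-reflexive (sum-map-+ (indicator ∘ S) (indicator ∘ S′) (allFin n)))
  where
  pointwise : ∀ b c → indicator (b ∨ c) ≤ indicator b + indicator c
  pointwise false c = ≤-refl
  pointwise true  c = s≤s z≤n

count-suc : ∀ {n} (S : Subset (suc n)) → count S ≡ indicator (S fzero) + count (S ∘ fsuc)
count-suc S = cong (λ xs → indicator (S fzero) + sum xs)
  (trans (map-tabulate fsuc (indicator ∘ S)) (≡-sym (map-tabulate id (indicator ∘ S ∘ fsuc))))

count-∅ : ∀ n → count {n} (λ _ → false) ≡ 0
count-∅ zero    = refl
count-∅ (suc n) = trans (count-suc {n} (λ _ → false)) (count-∅ n)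

count-singleton : ∀ {n} (v : Fin n) → count (λ u → does (u ≟ v)) ≡ 1
count-singleton {suc n} fzero    = trans (count-suc {n} (λ u → does (u ≟ fzero))) (cong suc (count-∅ n))
count-singleton {suc n} (fsuc v) = trans (count-suc (λ u → does (u ≟ fsuc v))) (count-singleton v)

-- Degree bounds are obtained by covering a set with a list, repetitions allowed, and a remainder
-- `S′`. The induction moves the head of the list into the remainder.
count-list : ∀ {n} {S S′ : Subset n} (L : List (Fin n)) →
             (∀ u → S u ≡ true → u ∈ L ⊎ S′ u ≡ true) → count S ≤ length L + count S′
count-list [] cover = count-mono λ u Su → [ (λ ()) , id ]′ (cover u Su)
count-list {S = S} {S′} (l ∷ L) cover = begin
  count S                                               ≤⟨ count-list L cover′ ⟩
  length L + count (λ u → does (u ≟ l) ∨ S′ u)          ≤⟨ +-monoʳ-≤ (length L) (count-∨ _ S′) ⟩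
  length L + (count (λ u → does (u ≟ l)) + count S′)    ≡⟨ cong (λ c → length L + (c + count S′)) (count-singleton l) ⟩
  length L + suc (count S′)                             ≡⟨ +-suc (length L) _ ⟩
  suc (length L + count S′)                             ∎
  where
  open ≤-Reasoning
  cover′ : ∀ u → S u ≡ true → u ∈ L ⊎ does (u ≟ l) ∨ S′ u ≡ true
  cover′ u Su with cover u Su
  ... | inj₁ (here refl) = inj₂ (cong (_∨ S′ u) (dec-true (u ≟ u) refl))
  ... | inj₁ (there u∈L) = inj₁ u∈L
  ... | inj₂ S′u         = inj₂ (trans (cong (does (u ≟ l) ∨_) S′u) (∨-zeroʳ _))

─⁺ : ∀ {n} (S : Subset n) {u v : Fin n} → S u ≡ true → u ≢ v → (S ─ v) u ≡ true
─⁺ S {u} {v} Su u≢v rewrite Su | dec-false (u ≟ v) u≢v = refl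

─⁻ : ∀ {n} (S : Subset n) {u v : Fin n} → (S ─ v) u ≡ true → S u ≡ true × u ≢ v
─⁻ S {u} {v} eq with S u | u ≟ v
─⁻ S {u} {v} eq | true | no u≢v = refl , u≢v

count-─ : ∀ {n} (S : Subset n) (v : Fin n) → S v ≡ true → suc (count (S ─ v)) ≤ count S
count-─ {n} S v Sv = begin
  suc (count (S ─ v))                                 ≡⟨ +-comm 1 _ ⟩
  count (S ─ v) + 1                                   ≡⟨ cong (count (S ─ v) +_) (count-singleton v) ⟨
  count (S ─ v) + count (λ u → does (u ≟ v))          ≡⟨ sum-map-+ (λ u → indicator ((S ─ v) u)) (λ u → indicator (does (u ≟ v))) (allFin n) ⟨
  sum (map (λ u → indicator ((S ─ v) u) + indicator (does (u ≟ v))) (allFin n)) ≤⟨ sum-map-mono pointwise (allFin n) ⟩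
  count S                                             ∎
  where
  open ≤-Reasoning
  pointwise : ∀ u → indicator ((S ─ v) u) + indicator (does (u ≟ v)) ≤ indicator (S u)
  pointwise u with u ≟ v
  ... | yes refl rewrite Sv = ≤-refl
  ... | no _ with S u
  ...   | true  = ≤-refl
  ...   | false = ≤-refl

count≤suc-─ : ∀ {n} (S : Subset n) (v : Fin n) → count S ≤ suc (count (S ─ v))
count≤suc-─ S v = count-list (v ∷ []) cover
  where
  cover : ∀ u → S u ≡ true → u ∈ v ∷ [] ⊎ (S ─ v) u ≡ true
  cover u Su with u ≟ v
  ... | yes refl = inj₁ (here refl)
  ... | no _ rewrite Su = inj₂ refl

-- Squares and inductiveness

∨-true⁻ : ∀ {b c} → b ∨ c ≡ true → b ≡ true ⊎ c ≡ true
∨-true⁻ {true}  _  = inj₁ refl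
∨-true⁻ {false} eq = inj₂ eq

∧-true⁻ : ∀ {b c} → b ∧ c ≡ true → b ≡ true × c ≡ true
∧-true⁻ {true} eq = refl , eq

adj⇒≢ : ∀ {n} (G : Graph n) {u v} → adj G u v ≡ true → u ≢ v
adj⇒≢ G {u} uv refl with trans (≡-sym uv) (irrefl G u)
... | ()

Near : ∀ {n} → Graph n → Fin n → Fin n → Set
Near G u v = adj G u v ≡ true ⊎ ∃ λ w → adj G u w ≡ true × adj G w v ≡ true

square⁻ : ∀ {n} (G : Graph n) {u v} → square G u v ≡ true → u ≢ v × Near G u v
square⁻ {n} G {u} {v} eq with u ≟ v
... | no u≢v with ∨-true⁻ {adj G u v} eq
...   | inj₁ uv = u≢v , inj₁ uv
...   | inj₂ uwv with satisfied (any⁻ _ (allFin n) (Equivalence.from T-≡ uwv))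
...     | w , t = u≢v , inj₂ (w , ∧-true⁻ (Equivalence.to T-≡ t))

square⁺ : ∀ {n} (G : Graph n) {u v} → u ≢ v → Near G u v → square G u v ≡ true
square⁺ G {u} {v} u≢v near with u ≟ v
... | yes u≡v = contradiction u≡v u≢v
square⁺ G u≢v (inj₁ uv) | no _ rewrite uv = refl
square⁺ G {u} {v} u≢v (inj₂ (w , uw , wv)) | no _ =
  trans (cong (adj G u v ∨_) (Equivalence.to T-≡ (any⁺ _ (lose (∈-allFin w) (Equivalence.from T-≡ (cong₂ _∧_ uw wv)))))) (∨-zeroʳ _)

minList≤ : ∀ {x xs} → x ∈ xs → minList xs ≤ x
minList≤ {xs = x ∷ []}     (here refl) = ≤-refl
minList≤ {xs = x ∷ y ∷ xs} (here refl) = m⊓n≤m x _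
minList≤ {xs = x ∷ y ∷ xs} (there z∈)  = ≤-trans (m⊓n≤n x _) (minList≤ z∈)

≤minList : ∀ {k x xs} → x ∈ xs → All (k ≤_) xs → k ≤ minList xs
≤minList {xs = x ∷ []}     _ (k≤x ∷ _)  = k≤x
≤minList {xs = x ∷ y ∷ xs} _ (k≤x ∷ k≤) = ⊓-glb k≤x (≤minList (here refl) k≤)

∈-members⁺ : ∀ {n} {S : Subset n} {v} → S v ≡ true → v ∈ members S
∈-members⁺ {v = v} Sv = ∈-filter⁺ _ (∈-allFin v) (Equivalence.from T-≡ Sv)

∈-members⁻ : ∀ {n} {S : Subset n} {v} → v ∈ members S → S v ≡ true
∈-members⁻ {n} {S} v∈ = Equivalence.to T-≡ (proj₂ (∈-filter⁻ (λ v → T? (S v)) {xs = allFin n} v∈))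

ind≤ : ∀ {n} {A : Rel n} {K} →
       (∀ S v → S v ≡ true → ∃ λ u → S u ≡ true × degIn A S u ≤ K) → ind A ≤ K
ind≤ {n} {A} {K} small = go (allSubsets n)
  where
  minDeg≤ : ∀ S → minDegIn A S ≤ K
  minDeg≤ S with members S in eq
  ... | [] = z≤n
  ... | v ∷ _ with small S v (∈-members⁻ {S = S} (subst (v ∈_) (≡-sym eq) (here refl)))
  ...   | u , Su , du≤K =
        ≤-trans (minList≤ (∈-map⁺ (degIn A S) (subst (u ∈_) eq (∈-members⁺ {S = S} Su)))) du≤K
  go : ∀ Ss → foldr _⊔_ 0 (map (minDegIn A) Ss) ≤ K
  go []       = z≤n
  go (S ∷ Ss) = ⊔-lub (minDeg≤ S) (go Ss)

-- Without function extensionality, a subset occurs in the enumeration only up to pointwise equality.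
∈-allSubsets : ∀ n (S : Subset n) → ∃ λ S′ → S′ ∈ allSubsets n × (∀ u → S u ≡ S′ u)
∈-allSubsets zero    S = _ , here refl , λ ()
∈-allSubsets (suc n) S with ∈-allSubsets n (S ∘ fsuc) | S fzero in eq
... | S′ , S′∈ , S≗S′ | false =
  extend false S′ , ∈-concatMap⁺ _ (lose S′∈ (here refl)) , λ { fzero → eq ; (fsuc u) → S≗S′ u }
... | S′ , S′∈ , S≗S′ | true =
  extend true S′ , ∈-concatMap⁺ _ (lose S′∈ (there (here refl))) , λ { fzero → eq ; (fsuc u) → S≗S′ u }

≤ind : ∀ {n} {A : Rel n} {k} (S : Subset n) (v : Fin n) → S v ≡ true →
       (∀ u → S u ≡ true → k ≤ degIn A S u) → k ≤ ind A
≤ind {n} {A} {k} S v Sv large with ∈-allSubsets n S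
... | S′ , S′∈ , S≗S′ = ≤-trans minDeg (∈⇒≤foldr (∈-map⁺ (minDegIn A) S′∈))
  where
  ∈⇒≤foldr : ∀ {x xs} → x ∈ xs → x ≤ foldr _⊔_ 0 xs
  ∈⇒≤foldr (here refl)         = m≤m⊔n _ _
  ∈⇒≤foldr {xs = y ∷ _} (there x∈) = ≤-trans (∈⇒≤foldr x∈) (m≤n⊔m y _)
  member-large : ∀ {u} → u ∈ members S′ → k ≤ degIn A S′ u
  member-large {u} u∈ = ≤-trans (large u (trans (S≗S′ u) (∈-members⁻ {S = S′} u∈)))
                               (≤-reflexive (count-cong λ w → cong (_∧ A u w) (S≗S′ w)))
  minDeg : k ≤ minDegIn A S′
  minDeg = ≤minList (∈-map⁺ (degIn A S′) (∈-members⁺ {S = S′} (trans (≡-sym (S≗S′ v)) Sv)))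
                    (map⁺ (All.tabulate member-large))

-- A closed neighbourhood is a clique in the square.
deg≤ind-square : ∀ {n} (G : Graph n) (v : Fin n) → deg G v ≤ ind (square G)
deg≤ind-square {n} G v = ≤ind {A = square G} S v Sv large
  where
  S : Subset n
  S u = adj G v u ∨ does (u ≟ v)
  Sv : S v ≡ true
  Sv = trans (cong (adj G v v ∨_) (dec-true (v ≟ v) refl)) (∨-zeroʳ _)
  S⁻ : ∀ {u} → S u ≡ true → adj G v u ≡ true ⊎ u ≡ v
  S⁻ {u} Su with u ≟ v
  ... | yes u≡v = inj₂ u≡v
  ... | no _ with ∨-true⁻ {adj G v u} Su
  ...   | inj₁ vu = inj₁ vu
  near : ∀ {u w} → S u ≡ true → S w ≡ true → u ≢ w → Near G u w
  near {u} {w} Su Sw u≢w with S⁻ {u} Su | S⁻ {w} Sw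
  ... | inj₁ vu   | inj₁ vw   = inj₂ (v , trans (sym G u v) vu , vw)
  ... | inj₁ vu   | inj₂ refl = inj₁ (trans (sym G u v) vu)
  ... | inj₂ refl | inj₁ vw   = inj₁ vw
  ... | inj₂ refl | inj₂ refl = contradiction refl u≢w
  deg<S : suc (deg G v) ≤ count S
  deg<S = ≤-trans (s≤s (count-mono N⊆S─v)) (count-─ S v Sv)
    where
    N⊆S─v : ∀ u → adj G v u ≡ true → (S ─ v) u ≡ true
    N⊆S─v u vu = ─⁺ S (cong (_∨ does (u ≟ v)) vu) (adj⇒≢ G vu ∘ ≡-sym)
  large : ∀ u → S u ≡ true → deg G v ≤ degIn (square G) S u
  -- `S` has more than `deg G v` members, and all of them but `u` are adjacent to `u` in the square.
  large u Su = ≤-trans (≤-pred (≤-trans deg<S (count≤suc-─ S u))) (count-mono S─u⊆)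
    where
    S─u⊆ : ∀ w → (S ─ u) w ≡ true → S w ∧ square G u w ≡ true
    S─u⊆ w eq with ─⁻ S eq
    ... | Sw , w≢u = cong₂ _∧_ Sw (square⁺ G (w≢u ∘ ≡-sym) (near {u} {w} Su Sw (w≢u ∘ ≡-sym)))

-- Reducible vertices

-- An arbitrary total preorder lets one proof serve for the last vertex and, with the order
-- reversed, for the first.
extremal : ∀ {n} (_⊑_ : Fin n → Fin n → Set) → (∀ x y → x ⊑ y ⊎ y ⊑ x) →
           (∀ {x y z} → x ⊑ y → y ⊑ z → x ⊑ z) → {P : Fin n → Set} → (∀ x → Dec (P x)) →
           (∀ x → ¬ P x) ⊎ ∃ λ z → P z × (∀ x → P x → x ⊑ z)
extremal {zero}  _⊑_ total tr P? = inj₁ λ ()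
extremal {suc n} _⊑_ total tr P?
  with extremal (λ x y → fsuc x ⊑ fsuc y) (λ x y → total (fsuc x) (fsuc y)) tr (λ x → P? (fsuc x)) | P? fzero
... | inj₁ none | no ¬p0 = inj₁ λ { fzero → ¬p0 ; (fsuc x) → none x }
... | inj₁ none | yes p0 = inj₂ (fzero , p0 , λ { fzero _ → [ id , id ]′ (total fzero fzero) ; (fsuc x) p → ⊥-elim (none x p) })
... | inj₂ (z , pz , top) | no ¬p0 = inj₂ (fsuc z , pz , λ { fzero p → ⊥-elim (¬p0 p) ; (fsuc x) p → top x p })
... | inj₂ (z , pz , top) | yes p0 with total fzero (fsuc z)
...   | inj₁ 0⊑z = inj₂ (fsuc z , pz , λ { fzero _ → 0⊑z ; (fsuc x) p → top x p })
...   | inj₂ z⊑0 = inj₂ (fzero , p0 , λ { fzero _ → [ id , id ]′ (total fzero fzero) ; (fsuc x) p → tr (top x p) z⊑0 })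

pattern #0   = here refl
pattern #1   = there #0
pattern #2   = there #1
pattern #3   = there #2
pattern #4   = there #3

NonCrossing : ∀ {n} → Graph n → (Fin n → ℕ) → Set
NonCrossing G pos = ∀ a b c d → adj G a b ≡ true → adj G c d ≡ true →
  ¬ (pos a < pos c × pos c < pos b × pos b < pos d)

-- Eliminated vertices stay in `Fin n` as isolated vertices outside `Active`. The alternatives in
-- `slack` are the two uses, K = Δ + 1 and K = Δ ≥ 7.
module Reducibility {n} (G : Graph n) (pos : Fin n → ℕ) (pos-injective : ∀ {x y} → pos x ≡ pos y → x ≡ y)
  (non-crossing : NonCrossing G pos) (Active : Subset n)
  (edge-active : ∀ {x y} → adj G x y ≡ true → Active x ≡ true)
  {Δ K : ℕ} (deg≤Δ : ∀ v → deg G v ≤ Δ) (Δ≤K : Δ ≤ K) (6≤K : 6 ≤ K) (slack : suc Δ ≤ K ⊎ 7 ≤ K) where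

  V : Set
  V = Fin n

  infix 4 _~_ _≺_ _≼_

  _~_ _≺_ _≼_ : V → V → Set
  x ~ y = adj G x y ≡ true
  x ≺ y = pos x < pos y
  x ≼ y = pos x ≤ pos y

  ~-sym : ∀ {x y} → x ~ y → y ~ x
  ~-sym {x} {y} = trans (sym G y x)

  -- Symmetric in the two ends, so that configurations can be mirrored.
  Between : V → V → V → Set
  Between a b u = (a ≺ u × u ≺ b) ⊎ (b ≺ u × u ≺ a)

  -- Only an upper bound on the neighbourhood: consecutive vertices of a face need not be adjacent,
  -- yet each is listed for the other.
  Nbrs : V → List V → Set
  Nbrs v L = ∀ {u} → v ~ u → u ∈ L

  Inside : V → V → List V → Set
  Inside a b L = ∀ {u} → Active u ≡ true → Between a b u → u ∈ L

  InsideNbrs : V → V → List V → Set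
  InsideNbrs a b L = ∀ {u} → a ~ u → Between a b u → u ∈ L

  record Reducible : Set where
    field
      vertex    : V
      active    : Active vertex ≡ true
      nbr₁ nbr₂ : V
      nbrs      : Nbrs vertex (nbr₁ ∷ nbr₂ ∷ [])
      small     : degR (square G) vertex ≤ K

  square-bound : ∀ v (L : List V) (Q : Subset n) →
                 (∀ {z} → z ≢ v → Near G v z → z ∈ L ⊎ Q z ≡ true) → degR (square G) v ≤ length L + count Q
  square-bound v L Q cover = count-list L λ z vz → let v≢z , near = square⁻ G vz in cover (v≢z ∘ ≡-sym) near

  square-list : ∀ v (L : List V) → (∀ {z} → z ≢ v → Near G v z → z ∈ L) → degR (square G) v ≤ length L
  square-list v L cover = ≤-trans (square-bound v L (λ _ → false) λ z≢v near → inj₁ (cover z≢v near))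
                                  (≤-reflexive (trans (cong (length L +_) (count-∅ n)) (+-identityʳ _)))

  Covered : V → List V → List V → Set
  Covered v L = All (λ z → z ≡ v ⊎ z ∈ L)

  -- Whatever is near `v` is `u`, `w` or a neighbour of one of them, so `L` lists the whole
  -- neighbourhood of `v` in the square.
  reducible-local : ∀ {v u w Lu Lw} → Active v ≡ true → Nbrs v (u ∷ w ∷ []) → Nbrs u Lu → Nbrs w Lw →
                    ∀ L → u ∈ L → w ∈ L → Covered v L Lu → Covered v L Lw → length L ≤ K → Reducible
  reducible-local {v} {u} {w} act nv nu nw L u∈ w∈ cu cw len = record
    { active = act ; nbrs = nv ; small = ≤-trans (square-list v L cover) len }
    where
    cover : ∀ {z} → z ≢ v → Near G v z → z ∈ L
    cover z≢v (inj₁ vz) with nv vz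
    ... | #0 = u∈
    ... | #1 = w∈
    cover z≢v (inj₂ (y , vy , yz)) with nv vy
    ... | #0 = [ ⊥-elim ∘ z≢v , id ]′ (All.lookup cu (nu yz))
    ... | #1 = [ ⊥-elim ∘ z≢v , id ]′ (All.lookup cw (nw yz))

  -- Here the neighbour a of v may have degree Δ; what helps is that most vertices near v are adjacent to a.
  reducible-high : ∀ {v a x Nx} L → Active v ≡ true → Nbrs v (a ∷ x ∷ []) → a ~ x → Nbrs x Nx → length Nx ≤ 5 →
                   All (λ z → z ≡ v ⊎ z ≡ a ⊎ a ~ z ⊎ z ∈ L) Nx → length L + Δ ≤ K → Reducible
  reducible-high {v} {a} {x} {Nx} L act nv ax nx |Nx|≤5 cx len = record { active = act ; nbrs = nv ; small = bound }
    where
    bound : degR (square G) v ≤ K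
    bound with adj G a v in av
    ... | true = begin
      -- Counting `a` itself is paid for by omitting `v` from the neighbours of `a`; `x` is one of
      -- these neighbours.
      degR (square G) v                              ≤⟨ square-bound v (a ∷ L) (adj G a ─ v) cover ⟩
      suc (length L) + count (adj G a ─ v)           ≡⟨ +-suc (length L) _ ⟨
      length L + suc (count (adj G a ─ v))           ≤⟨ +-monoʳ-≤ (length L) (count-─ (adj G a) v av) ⟩
      length L + deg G a                             ≤⟨ +-monoʳ-≤ (length L) (deg≤Δ a) ⟩
      length L + Δ                                   ≤⟨ len ⟩
      K                                              ∎
      where
      open ≤-Reasoning
      cover : ∀ {z} → z ≢ v → Near G v z → z ∈ a ∷ L ⊎ (adj G a ─ v) z ≡ true
      cover z≢v (inj₁ vz) with nv vz
      ... | #0 = inj₁ #0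
      ... | #1 = inj₂ (─⁺ (adj G a) ax z≢v)
      cover z≢v (inj₂ (y , vy , yz)) with nv vy
      ... | #0 = inj₂ (─⁺ (adj G a) yz z≢v)
      ... | #1 with All.lookup cx (nx yz)
      ...   | inj₁ z≡v                  = contradiction z≡v z≢v
      ...   | inj₂ (inj₁ refl)          = inj₁ #0
      ...   | inj₂ (inj₂ (inj₁ az))     = inj₂ (─⁺ (adj G a) az z≢v)
      ...   | inj₂ (inj₂ (inj₂ z∈L))    = inj₁ (there z∈L)
    -- If `v` is not adjacent to `a`, only `x` and its at most five neighbours are near `v`.
    ... | false = ≤-trans (square-list v (x ∷ Nx) cover) (≤-trans (s≤s |Nx|≤5) 6≤K)
      where
      v≁a : ¬ (v ~ a)
      v≁a va with trans (≡-sym av) (~-sym va)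
      ... | ()
      cover : ∀ {z} → z ≢ v → Near G v z → z ∈ x ∷ Nx
      cover z≢v (inj₁ vz) with nv vz
      ... | #0 = contradiction vz v≁a
      ... | #1 = #0
      cover z≢v (inj₂ (y , vy , yz)) with nv vy
      ... | #0 = contradiction vy v≁a
      ... | #1 = there (nx yz)

  -- Configurations inside a chord

  -- An ear carries the edge `a ~ b` because `reducible-high` needs the two neighbours of its vertex
  -- to be adjacent.
  data Light (a b : V) : Set where
    empty : Inside a b [] → Light a b
    ear   : ∀ v → Active v ≡ true → Inside a b (v ∷ []) → Nbrs v (a ∷ b ∷ []) → a ~ b → Light a b

  ears : ∀ {a b} → Light a b → List V
  ears (empty _)         = []
  ears (ear v _ _ _ _)   = v ∷ []

  length-ears : ∀ {a b} (l : Light a b) → length (ears l) ≤ 1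
  length-ears (empty _)       = z≤n
  length-ears (ear _ _ _ _ _) = ≤-refl

  ears-inside : ∀ {a b} (l : Light a b) → Inside a b (ears l)
  ears-inside (empty i)       = i
  ears-inside (ear _ _ i _ _) = i

  inside-nbrs : ∀ {a b L} → Inside a b L → InsideNbrs a b L
  inside-nbrs i au btw = i (edge-active (~-sym au)) btw

  inside-swap : ∀ {a b L} → Inside a b L → Inside b a L
  inside-swap i act btw = i act (Sum.swap btw)

  pair-swap : ∀ {u a b : V} → u ∈ a ∷ b ∷ [] → u ∈ b ∷ a ∷ []
  pair-swap #0 = #1
  pair-swap #1 = #0

  light-swap : ∀ {a b} → Light a b → Light b a
  light-swap (empty i)          = empty (inside-swap i)
  light-swap (ear v act i nv ab) = ear v act (inside-swap i) (pair-swap ∘ nv) (~-sym ab)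

  ears-swap : ∀ {a b} (l : Light a b) → ears (light-swap l) ≡ ears l
  ears-swap (empty _)       = refl
  ears-swap (ear _ _ _ _ _) = refl

  -- A configuration at the chord ab that yields a reducible vertex as soon as
  -- b has at most three neighbours besides a and those below the chord.
  record Heavy (a b : V) : Set where
    field
      below        : List V
      length-below : length below ≤ 2
      below-nbrs   : InsideNbrs b a below
      reducible    : ∀ R → length R ≤ 3 → Nbrs b (a ∷ below ++ R) → Reducible

  -- Heaviness is kept at both ends, since either end may be the one of small degree on the face
  -- above.
  Shape : V → V → Set
  Shape a b = Light a b ⊎ (Heavy a b × Heavy b a)

  shape-swap : ∀ {a b} → Shape a b → Shape b a
  shape-swap = Sum.map light-swap (λ (h , h′) → h′ , h)

  shape-below : ∀ {a b} → Shape a b → ∃ λ L → length L ≤ 2 × InsideNbrs b a L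
  shape-below (inj₁ l)       = ears l , m≤n⇒m≤1+n (length-ears l) , inside-nbrs (inside-swap (ears-inside l))
  shape-below (inj₂ (h , _)) = Heavy.below h , Heavy.length-below h , Heavy.below-nbrs h

  -- Triangular and quadrilateral faces

  record Two (a b : V) : Set where
    field
      x         : V
      left      : Light a x
      right     : Light x b
      active    : Active x ≡ true
      x-nbrs    : Nbrs x (a ∷ b ∷ ears left ++ ears right)
      a-nbrs    : InsideNbrs a b (x ∷ ears left)
      b-nbrs    : InsideNbrs b a (x ∷ ears right)

  -- The face a, x, y, b. Its middle side cuts off nothing, by `middle-empty`, so `x` and `y` have
  -- ears only on their outer sides.
  record Three (a b : V) : Set where
    field
      x y       : V
      left      : Light a x
      right     : Light y b
      x-active  : Active x ≡ true
      y-active  : Active y ≡ true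
      x-nbrs    : Nbrs x (a ∷ y ∷ ears left)
      y-nbrs    : Nbrs y (x ∷ b ∷ ears right)
      a-nbrs    : InsideNbrs a b (x ∷ ears left)
      b-nbrs    : InsideNbrs b a (y ∷ ears right)

  two-swap : ∀ {a b} → Two a b → Two b a
  two-swap {a} {b} t = record
    { x = x ; left = light-swap right ; right = light-swap left ; active = active
    ; x-nbrs = λ {u} xu → permute (x-nbrs xu)
    ; a-nbrs = λ {u} → subst (λ E → InsideNbrs b a (x ∷ E)) (≡-sym (ears-swap right)) b-nbrs
    ; b-nbrs = λ {u} → subst (λ E → InsideNbrs a b (x ∷ E)) (≡-sym (ears-swap left)) a-nbrs }
    where
    open Two t
    permute : ∀ {u} → u ∈ a ∷ b ∷ ears left ++ ears right → u ∈ b ∷ a ∷ ears (light-swap right) ++ ears (light-swap left)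
    permute #0 = #1
    permute #1 = #0
    permute (there (there p)) rewrite ears-swap left | ears-swap right with ∈-++⁻ (ears left) p
    ... | inj₁ q = there (there (∈-++⁺ʳ (ears right) q))
    ... | inj₂ q = there (there (∈-++⁺ˡ q))

  three-swap : ∀ {a b} → Three a b → Three b a
  three-swap {a} {b} t = record
    { x = y ; y = x ; left = light-swap right ; right = light-swap left ; x-active = y-active ; y-active = x-active
    ; x-nbrs = λ yu → exchange (ears-swap right) (y-nbrs yu)
    ; y-nbrs = λ xu → exchange (ears-swap left) (x-nbrs xu)
    ; a-nbrs = λ {u} → subst (λ E → InsideNbrs b a (y ∷ E)) (≡-sym (ears-swap right)) b-nbrs
    ; b-nbrs = λ {u} → subst (λ E → InsideNbrs a b (x ∷ E)) (≡-sym (ears-swap left)) a-nbrs }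
    where
    open Three t
    exchange : ∀ {u c d E E′} → E′ ≡ E → u ∈ c ∷ d ∷ E → u ∈ d ∷ c ∷ E′
    exchange refl #0                 = #1
    exchange refl #1                 = #0
    exchange refl (there (there p))  = there (there p)

  tail-covered : ∀ {v L} {R : List V} → (∀ {z} → z ∈ R → z ∈ L) → Covered v L R
  tail-covered R⊆L = All.tabulate (inj₂ ∘ R⊆L)

  -- The vertex is the ear `w` at `b`. Near it are `x`, `b`, `a`, at most one ear on the left and
  -- the at most three members of `R`: seven in all.
  two-heavy : ∀ {a b} (t : Two a b) → 7 ≤ K → length (ears (Two.right t)) ≡ 1 → Heavy a b
  two-heavy {a} {b} t 7≤K _ with Two.right t | Two.x-nbrs t | Two.b-nbrs t
  ... | ear w w-act _ nw _ | nx | nb = record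
    { below = x ∷ w ∷ [] ; length-below = ≤-refl ; below-nbrs = λ {u} → nb
    ; reducible = λ R |R|≤3 nb′ → reducible-local w-act nw nx nb′ (x ∷ b ∷ a ∷ ears left ++ R) #0 #1
        (inj₂ #2 ∷ inj₂ #1 ∷ ++⁺ (tail-covered (λ p → there (there (there (∈-++⁺ˡ p))))) (inj₁ refl ∷ []))
        (inj₂ #2 ∷ inj₂ #0 ∷ inj₁ refl ∷ tail-covered (λ p → there (there (there (∈-++⁺ʳ (ears left) p)))))
        (≤-trans (s≤s (s≤s (s≤s (≤-trans (≤-reflexive (length-++ (ears left))) (+-mono-≤ (length-ears left) |R|≤3))))) 7≤K) }
    where open Two t using (x; left)

  -- With an ear `w` at `b`, the vertex is `w`, and `y`, `b`, `x`, `a` and `R` make seven. Otherwise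
  -- it is `y`, with `x`, `b`, `a`, `R` and a possible left ear: seven again, but six if there is no
  -- ear at all. This is the meaning of `room`.
  three-heavy : ∀ {a b} (t : Three a b) → 7 ≤ K ⊎ length (ears (Three.left t) ++ ears (Three.right t)) ≡ 0 → Heavy a b
  three-heavy {a} {b} t room with Three.right t | Three.y-nbrs t | Three.b-nbrs t
  ... | ear w w-act _ nw _ | ny | nb = record
    { below = y ∷ w ∷ [] ; length-below = ≤-refl ; below-nbrs = λ {u} → nb
    ; reducible = λ R |R|≤3 nb′ → reducible-local w-act nw ny nb′ (y ∷ b ∷ x ∷ a ∷ R) #0 #1
        (inj₂ #2 ∷ inj₂ #1 ∷ inj₁ refl ∷ [])
        (inj₂ #3 ∷ inj₂ #0 ∷ inj₁ refl ∷ tail-covered (λ p → there (there (there (there p)))))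
        (≤-trans (s≤s (s≤s (s≤s (s≤s |R|≤3)))) (7≤K room)) }
    where
    open Three t using (x; y; left)
    7≤K : 7 ≤ K ⊎ length (ears left ++ w ∷ []) ≡ 0 → 7 ≤ K
    7≤K (inj₁ 7≤K) = 7≤K
    7≤K (inj₂ eq) with ears left
    7≤K (inj₂ ()) | []
    7≤K (inj₂ ()) | _ ∷ _
  ... | empty _ | ny | nb = record
    { below = y ∷ [] ; length-below = s≤s z≤n ; below-nbrs = λ {u} → nb
    ; reducible = λ R |R|≤3 nb′ → reducible-local y-active ny x-nbrs nb′ (x ∷ b ∷ a ∷ ears left ++ R) #0 #1
        (inj₂ #2 ∷ inj₁ refl ∷ tail-covered (λ p → there (there (there (∈-++⁺ˡ p)))))
        (inj₂ #2 ∷ inj₁ refl ∷ tail-covered (λ p → there (there (there (∈-++⁺ʳ (ears left) p)))))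
        (len R |R|≤3 room) }
    where
    open Three t using (x; y; left; x-nbrs; y-active)
    len : ∀ R → length R ≤ 3 → 7 ≤ K ⊎ length (ears left ++ []) ≡ 0 → 3 + length (ears left ++ R) ≤ K
    len R |R|≤3 (inj₁ 7≤K) =
      ≤-trans (s≤s (s≤s (s≤s (≤-trans (≤-reflexive (length-++ (ears left))) (+-mono-≤ (length-ears left) |R|≤3))))) 7≤K
    len R |R|≤3 (inj₂ eq) with ears left
    ... | [] = ≤-trans (s≤s (s≤s (s≤s |R|≤3))) 6≤K

  data Face (a b : V) : Set where
    void  : Inside a b [] → Face a b
    two   : (t : Two a b) → Inside a b (Two.x t ∷ ears (Two.left t) ++ ears (Two.right t)) → Face a b
    three : (t : Three a b) → Inside a b (Three.x t ∷ ears (Three.left t) ++ Three.y t ∷ ears (Three.right t)) → Face a b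

  -- Take the left ear. Since `b` is adjacent to `a`, the neighbours of `x` that `reducible-high`
  -- has to count separately are just the right ears.
  two-one-ear : ∀ {a b} (t : Two a b) → a ~ b → length (ears (Two.left t)) ≡ 1 →
                length (ears (Two.right t)) + Δ ≤ K → Reducible
  two-one-ear t ab _ room with Two.left t | Two.x-nbrs t
  ... | ear v act _ nv ax | nx = reducible-high (ears right) act nv ax nx
    (s≤s (s≤s (s≤s (≤-trans (length-ears right) (s≤s z≤n)))))
    (inj₂ (inj₁ refl) ∷ inj₂ (inj₂ (inj₁ ab)) ∷ inj₁ refl ∷ All.tabulate (λ p → inj₂ (inj₂ (inj₂ p)))) room
    where open Two t using (right)

  -- As for the triangle, but `y` need not be adjacent to `a`; it costs the extra one.
  three-ear : ∀ {a b} (t : Three a b) → length (ears (Three.left t)) ≡ 1 → suc Δ ≤ K → Reducible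
  three-ear t _ room with Three.left t | Three.x-nbrs t
  ... | ear v act _ nv ax | nx = reducible-high (Three.y t ∷ []) act nv ax nx (s≤s (s≤s (s≤s z≤n)))
    (inj₂ (inj₁ refl) ∷ inj₂ (inj₂ (inj₂ #0)) ∷ inj₁ refl ∷ []) room

  -- One ear on a triangle is reducible with the bound Δ. Two ears on a triangle, or any ear on a
  -- quadrilateral, require Δ + 1; if K may equal Δ they become heavy configurations instead, which
  -- K ≥ 7 permits.
  chord-shape : ∀ {a b} → a ~ b → Face a b → Reducible ⊎ Shape a b
  chord-shape ab (void i) = inj₂ (inj₁ (empty i))
  chord-shape ab (two t@record { left = empty _ ; right = empty _ } i) =
    inj₂ (inj₁ (ear (Two.x t) (Two.active t) i (Two.x-nbrs t) ab))
  chord-shape ab (two t@record { left = ear _ _ _ _ _ ; right = empty _ } i) =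
    inj₁ (two-one-ear t ab refl Δ≤K)
  chord-shape ab (two t@record { left = empty _ ; right = ear _ _ _ _ _ } i) =
    inj₁ (two-one-ear (two-swap t) (~-sym ab) refl Δ≤K)
  chord-shape ab (two t@record { left = ear _ _ _ _ _ ; right = ear _ _ _ _ _ } i) =
    [ (λ Δ<K → inj₁ (two-one-ear t ab refl Δ<K))
    , (λ 7≤K → inj₂ (inj₂ (two-heavy t 7≤K refl , two-heavy (two-swap t) 7≤K refl))) ]′ slack
  chord-shape ab (three t@record { left = empty _ ; right = empty _ } i) =
    inj₂ (inj₂ (three-heavy t (inj₂ refl) , three-heavy (three-swap t) (inj₂ refl)))
  chord-shape ab (three t@record { left = ear _ _ _ _ _ } i) =
    [ (λ Δ<K → inj₁ (three-ear t refl Δ<K))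
    , (λ 7≤K → inj₂ (inj₂ (three-heavy t (inj₁ 7≤K) , three-heavy (three-swap t) (inj₁ 7≤K)))) ]′ slack
  chord-shape ab (three t@record { left = empty _ ; right = ear _ _ _ _ _ } i) =
    [ (λ Δ<K → inj₁ (three-ear (three-swap t) refl Δ<K))
    , (λ 7≤K → inj₂ (inj₂ (three-heavy t (inj₁ 7≤K) , three-heavy (three-swap t) (inj₁ 7≤K)))) ]′ slack

  -- Walking along a face

  Span : V → V → Set
  Span y z = y ~ z ⊎ Inside y z []

  -- This replaces the edge ab in the walk: it follows from that edge by non-crossing, and it also
  -- holds when a and b are the extreme active vertices, adjacent or not.
  Closed : V → V → Set
  Closed a b = ∀ {x z} → x ~ z → a ≺ x → x ≺ b → a ≼ z × z ≼ b

  -- Expresses that `y` lies on the face below ab: only ab itself may pass over it.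
  Cut : V → V → V → Set
  Cut a b y = ∀ {x z} → x ~ z → a ≼ x → x ≺ y → y ≺ z → z ≼ b → x ≡ a × z ≡ b

  chord-closed : ∀ {a b} → a ~ b → Closed a b
  chord-closed {a} {b} ab {x} {z} xz a≺x x≺b =
    ≮⇒≥ (λ z≺a → non-crossing z x a b (~-sym xz) ab (z≺a , a≺x , x≺b)) ,
    ≮⇒≥ (λ b≺z → non-crossing a b x z ab xz (a≺x , x≺b , b≺z))

  span-cut : ∀ {y z x w} → Span y z → x ~ w → y ≺ x → x ≺ z → ¬ (z ≺ w)
  span-cut {y} {z} {x} {w} (inj₁ yz) xw y≺x x≺z z≺w = non-crossing y z x w yz xw (y≺x , x≺z , z≺w)
  span-cut (inj₂ i) xw y≺x x≺z z≺w with i (edge-active xw) (inj₁ (y≺x , x≺z))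
  ... | ()

  -- The next vertex of the face is the last later neighbour of `y` before `c`; failing that, the
  -- next active vertex, and then the side is a gap with nothing active inside.
  farthest : ∀ y c {w} → Active w ≡ true → y ≺ w → pos w < c →
             ∃ λ z → Active z ≡ true × y ≺ z × pos z < c × Span y z ×
                     (∀ {x} → y ~ x → y ≺ x → pos x < c → x ≼ z)
  farthest y c {w} w-act y≺w w<c
    with extremal _≼_ (λ x z → ≤-total (pos x) (pos z)) ≤-trans
           (λ x → (adj G y x Bool.≟ true) ×-dec (pos y <? pos x) ×-dec (pos x <? c))
  ... | inj₂ (z , (yz , y≺z , z<c) , top) =
        z , edge-active (~-sym yz) , y≺z , z<c , inj₁ yz , λ {x} yx y≺x x<c → top x (yx , y≺x , x<c)
  ... | inj₁ none
    with extremal (λ x z → z ≼ x) (λ x z → ≤-total (pos z) (pos x)) (λ p q → ≤-trans q p)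
           (λ x → (Active x Bool.≟ true) ×-dec (pos y <? pos x) ×-dec (pos x <? c))
  ...   | inj₁ none′ = ⊥-elim (none′ w (w-act , y≺w , w<c))
  ...   | inj₂ (z , (z-act , y≺z , z<c) , bottom) =
          z , z-act , y≺z , z<c , inj₂ inside , λ {x} yx y≺x x<c → ⊥-elim (none x (yx , y≺x , x<c))
    where
    inside : Inside y z []
    inside u-act (inj₁ (y≺u , u≺z)) = ⊥-elim (<⇒≱ u≺z (bottom _ (u-act , y≺u , <-trans u≺z z<c)))
    inside u-act (inj₂ (z≺u , u≺y)) = ⊥-elim (<-asym y≺z (<-trans z≺u u≺y))

  record Step (a b y : V) : Set where
    field
      {z}    : V
      active : Active z ≡ true
      y≺z    : y ≺ z
      z≼b    : z ≼ b
      span   : Span y z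
      cut    : Cut a b z

  first-step : ∀ {a b w} → Active w ≡ true → a ≺ w → w ≺ b → ∃ λ (s : Step a b a) → Step.z s ≺ b
  -- The bound `pos b` is exclusive, which prevents the walk from taking ab itself.
  first-step {a} {b} w-act a≺w w≺b with farthest a (pos b) w-act a≺w w≺b
  ... | z , z-act , a≺z , z≺b , span , far =
    record { active = z-act ; y≺z = a≺z ; z≼b = <⇒≤ z≺b ; span = span ; cut = cut } , z≺b
    where
    cut : Cut a b z
    cut {x} {w} xw a≼x x≺z z≺w w≼b with m≤n⇒m<n∨m≡n a≼x | m≤n⇒m<n∨m≡n w≼b
    ... | inj₁ a≺x | _ = ⊥-elim (span-cut span xw a≺x x≺z z≺w)
    ... | inj₂ a≡x | inj₂ w≡b = ≡-sym (pos-injective a≡x) , pos-injective w≡b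
    ... | inj₂ a≡x | inj₁ w≺b with pos-injective a≡x
    ...   | refl = ⊥-elim (<⇒≱ z≺w (far xw (<-trans a≺z z≺w) w≺b))

  next-step : ∀ {a b y} → Active b ≡ true → y ≺ b → Cut a b y → Step a b y
  -- Here `suc (pos b)` allows the walk to arrive at `b`, which also serves as the witness that some
  -- active vertex remains.
  next-step {a} {b} {y} b-act y≺b y-cut with farthest y (suc (pos b)) b-act y≺b ≤-refl
  ... | z , z-act , y≺z , s≤s z≼b , span , far =
    record { active = z-act ; y≺z = y≺z ; z≼b = z≼b ; span = span ; cut = cut }
    where
    cut : Cut a b z
    -- An edge over `z` from before `y` also passes over `y`; one from beyond `y` crosses the new
    -- side; one from `y` contradicts the choice of `z`.
    cut {x} {w} xw a≼x x≺z z≺w w≼b with <-cmp (pos x) (pos y)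
    ... | tri< x≺y _ _ = y-cut xw a≼x x≺y (<-trans y≺z z≺w) w≼b
    ... | tri> _ _ y≺x = ⊥-elim (span-cut span xw y≺x x≺z z≺w)
    ... | tri≈ _ x≡y _ with pos-injective x≡y
    ...   | refl = ⊥-elim (<⇒≱ z≺w (far xw (<-trans y≺z z≺w) (s≤s w≼b)))

  cut-left : ∀ {a b} → Cut a b a
  cut-left xz a≼x x≺a _ _ = ⊥-elim (<⇒≱ x≺a a≼x)

  FaceNbrs : V → V → V → Set
  FaceNbrs c y d = ∀ {R₁ R₂} → InsideNbrs y c R₁ → InsideNbrs y d R₂ → Nbrs y (c ∷ d ∷ R₁ ++ R₂)

  -- An edge from `y` beyond `c` or `d` stays within the interval by `Closed` and passes over a
  -- vertex of the face. By `Cut` it would be ab, but `y` lies strictly between `a` and `b`.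
  face-nbrs : ∀ {a b c y d} → Closed a b → a ≺ y → y ≺ b → Cut a b c → Cut a b d → c ≺ y → y ≺ d → FaceNbrs c y d
  face-nbrs {a} {b} {c} {y} {d} closed a≺y y≺b c-cut d-cut c≺y y≺d {R₁} {R₂} n₁ n₂ {u} yu =
    locate (m≤n⇒m<n∨m≡n (≮⇒≥ u⊀c)) (m≤n⇒m<n∨m≡n (≮⇒≥ d⊀u)) (<-cmp (pos u) (pos y))
    where
    u⊀c : ¬ (u ≺ c)
    u⊀c u≺c = <-irrefl (cong pos (proj₂ (c-cut (~-sym yu) (proj₁ (closed yu a≺y y≺b)) u≺c c≺y (<⇒≤ y≺b)))) y≺b
    d⊀u : ¬ (d ≺ u)
    d⊀u d≺u = <-irrefl (cong pos (≡-sym (proj₁ (d-cut yu (<⇒≤ a≺y) y≺d d≺u (proj₂ (closed yu a≺y y≺b)))))) a≺y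
    locate : c ≺ u ⊎ pos c ≡ pos u → u ≺ d ⊎ pos u ≡ pos d → Tri (u ≺ y) (pos u ≡ pos y) (y ≺ u) → u ∈ c ∷ d ∷ R₁ ++ R₂
    locate (inj₂ c≡u) _ _ = here (≡-sym (pos-injective c≡u))
    locate _ (inj₂ u≡d) _ = there (here (pos-injective u≡d))
    locate (inj₁ c≺u) (inj₁ u≺d) (tri< u≺y _ _) = there (there (∈-++⁺ˡ (n₁ yu (inj₂ (c≺u , u≺y)))))
    locate (inj₁ c≺u) (inj₁ u≺d) (tri> _ _ y≺u) = there (there (∈-++⁺ʳ R₁ (n₂ yu (inj₁ (y≺u , u≺d)))))
    locate (inj₁ c≺u) (inj₁ u≺d) (tri≈ _ u≡y _) = ⊥-elim (adj⇒≢ G yu (≡-sym (pos-injective u≡y)))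

  left-nbrs : ∀ {a b y L} → a ≺ b → Cut a b y → a ≺ y → InsideNbrs a y L → InsideNbrs a b (y ∷ L)
  left-nbrs a≺b cut a≺y i au (inj₂ (b≺u , u≺a)) = ⊥-elim (<-asym a≺b (<-trans b≺u u≺a))
  left-nbrs {y = y} a≺b cut a≺y i {u} au (inj₁ (a≺u , u≺b)) with <-cmp (pos u) (pos y)
  ... | tri< u≺y _ _ = there (i au (inj₁ (a≺u , u≺y)))
  ... | tri≈ _ u≡y _ = here (pos-injective u≡y)
  ... | tri> _ _ y≺u with cut au ≤-refl a≺y y≺u (<⇒≤ u≺b)
  ...   | _ , refl = ⊥-elim (<-irrefl refl u≺b)

  right-nbrs : ∀ {a b y L} → a ≺ b → Cut a b y → y ≺ b → InsideNbrs b y L → InsideNbrs b a (y ∷ L)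
  right-nbrs a≺b cut y≺b i bu (inj₁ (b≺u , u≺a)) = ⊥-elim (<-asym a≺b (<-trans b≺u u≺a))
  right-nbrs {y = y} a≺b cut y≺b i {u} bu (inj₂ (a≺u , u≺b)) with <-cmp (pos u) (pos y)
  ... | tri> _ _ y≺u = there (i bu (inj₂ (y≺u , u≺b)))
  ... | tri≈ _ u≡y _ = here (pos-injective u≡y)
  ... | tri< u≺y _ _ with cut (~-sym bu) (<⇒≤ a≺u) u≺y y≺b ≤-refl
  ...   | refl , _ = ⊥-elim (<-irrefl refl a≺u)

  inside-join : ∀ {a x b L₁ L₂} → a ≺ x → x ≺ b → Inside a x L₁ → Inside x b L₂ → Inside a b (x ∷ L₁ ++ L₂)
  inside-join a≺x x≺b i₁ i₂ act (inj₂ (b≺u , u≺a)) = ⊥-elim (<-asym (<-trans a≺x x≺b) (<-trans b≺u u≺a))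
  inside-join {x = x} {L₁ = L₁} a≺x x≺b i₁ i₂ {u} act (inj₁ (a≺u , u≺b)) with <-cmp (pos u) (pos x)
  ... | tri< u≺x _ _ = there (∈-++⁺ˡ (i₁ act (inj₁ (a≺u , u≺x))))
  ... | tri≈ _ u≡x _ = here (pos-injective u≡x)
  ... | tri> _ _ x≺u = there (∈-++⁺ʳ L₁ (i₂ act (inj₁ (x≺u , u≺b))))

  -- If one side at `y` is heavy, the remaining neighbours of `y` are the other face neighbour and
  -- at most two below the other side: the three that `Heavy` tolerates.
  both-light : ∀ {c y d} → FaceNbrs c y d → Shape c y → Shape y d → Reducible ⊎ (Light c y × Light y d)
  both-light nbrs (inj₁ l) (inj₁ r) = inj₂ (l , r)
  both-light {c} {y} {d} nbrs (inj₂ (h , _)) s with shape-below (shape-swap s)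
  ... | R , |R|≤2 , nR = inj₁ (Heavy.reducible h (d ∷ R) (s≤s |R|≤2) λ yu → permute (nbrs (Heavy.below-nbrs h) nR yu))
    where
    permute : ∀ {u L} → u ∈ c ∷ d ∷ L ++ R → u ∈ c ∷ L ++ d ∷ R
    permute #0 = #0
    permute {L = L} #1 = there (∈-++⁺ʳ L #0)
    permute {L = L} (there (there p)) with ∈-++⁻ L p
    ... | inj₁ q = there (∈-++⁺ˡ q)
    ... | inj₂ q = there (∈-++⁺ʳ L (there q))
  both-light {c} {y} {d} nbrs s@(inj₁ _) (inj₂ (_ , h)) with shape-below s
  ... | R , |R|≤2 , nR = inj₁ (Heavy.reducible h (c ∷ R) (s≤s |R|≤2) λ yu → permute (nbrs nR (Heavy.below-nbrs h) yu))
    where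
    permute : ∀ {u L} → u ∈ c ∷ d ∷ R ++ L → u ∈ d ∷ L ++ c ∷ R
    permute {L = L} #0 = there (∈-++⁺ʳ L #0)
    permute #1 = #0
    permute {L = L} (there (there p)) with ∈-++⁻ R p
    ... | inj₁ q = there (∈-++⁺ʳ L (there q))
    ... | inj₂ q = there (∈-++⁺ˡ q)

  light-nbrs : ∀ {c y d} → FaceNbrs c y d → (l : Light c y) (r : Light y d) → Nbrs y (c ∷ d ∷ ears l ++ ears r)
  light-nbrs nbrs l r = nbrs (inside-nbrs (inside-swap (ears-inside l))) (inside-nbrs (ears-inside r))

  length-two-ears : ∀ {a b c d} (l : Light a b) (r : Light c d) → 4 + length (ears l ++ ears r) ≤ K
  length-two-ears l r = ≤-trans (+-monoʳ-≤ 4 (≤-trans (≤-reflexive (length-++ (ears l))) (+-mono-≤ (length-ears l) (length-ears r)))) 6≤K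

  -- Near an ear on the side xy are only `x`, `y`, `c`, `d` and at most two ears of the adjacent
  -- sides, six in all.
  middle-empty : ∀ {c x y d} → FaceNbrs c x y → FaceNbrs x y d → Light c x → Light x y → Light y d →
                 Reducible ⊎ Inside x y []
  middle-empty nx ny l (empty i) r = inj₂ i
  middle-empty {c} {x} {y} {d} nx ny l m@(ear v act _ nv _) r = inj₁ (reducible-local act nv (light-nbrs nx l m) (light-nbrs ny m r)
    (x ∷ y ∷ c ∷ d ∷ ears l ++ ears r) #0 #1
    (inj₂ #2 ∷ inj₂ #1 ∷ ++⁺ (tail-covered (λ p → there (there (there (there (∈-++⁺ˡ p)))))) (inj₁ refl ∷ []))
    (inj₂ #0 ∷ inj₂ #3 ∷ inj₁ refl ∷ tail-covered (λ p → there (there (there (there (∈-++⁺ʳ (ears l) p))))))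
    (length-two-ears l r))

  -- Between two sides that cut off nothing, `y` sees only `x`, `z`, `c`, `d` and at most two ears.
  degree-two-run : ∀ {c x y z d} → Active y ≡ true → FaceNbrs c x y → FaceNbrs x y z → FaceNbrs y z d →
                   Light c x → Inside x y [] → Inside y z [] → Light z d → Reducible
  degree-two-run {c} {x} {y} {z} {d} y-act nx ny nz l i j r =
    reducible-local y-act (light-nbrs ny (empty i) (empty j)) (light-nbrs nx l (empty i)) (light-nbrs nz (empty j) r)
      (x ∷ z ∷ c ∷ d ∷ ears l ++ ears r) #0 #1
      (inj₂ #2 ∷ inj₁ refl ∷ ++⁺ (tail-covered (λ p → there (there (there (there (∈-++⁺ˡ p)))))) [])
      (inj₁ refl ∷ inj₂ #3 ∷ tail-covered (λ p → there (there (there (there (∈-++⁺ʳ (ears l) p))))))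
      (length-two-ears l r)

  -- The induction hypothesis. The disjunction makes the side strictly shorter than ab.
  SidesShaped : V → V → Set
  SidesShaped a b = ∀ {y z} → Active y ≡ true → Active z ≡ true → a ≼ y → y ≺ z → z ≼ b → a ≺ y ⊎ z ≺ b →
                    Span y z → Reducible ⊎ Shape y z

  module _ {a b : V} (a≺b : a ≺ b) (b-act : Active b ≡ true) (closed : Closed a b)
           (shape : SidesShaped a b) where

    infixr 1 _>>=_
    _>>=_ : {A B : Set} → Reducible ⊎ A → (A → Reducible ⊎ B) → Reducible ⊎ B
    inj₁ r >>= _ = inj₁ r
    inj₂ x >>= f = f x

    ends : ∀ {z} → z ≼ b → z ≡ b ⊎ z ≺ b
    ends z≼b = [ inj₂ , inj₁ ∘ pos-injective ]′ (m≤n⇒m<n∨m≡n z≼b)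

    walk : Active a ≡ true → ∀ {w} → Active w ≡ true → a ≺ w → w ≺ b → Reducible ⊎ Face a b
    walk a-act w-act a≺w w≺b with first-step w-act a≺w w≺b
    ... | s₁ , y₁≺b =
      shape a-act (active s₁) ≤-refl (y≺z s₁) (z≼b s₁) (inj₂ y₁≺b) (span s₁) >>= λ sh₁ →
      shape (active s₁) (active s₂) (<⇒≤ a≺y₁) (y≺z s₂) (z≼b s₂) (inj₁ a≺y₁) (span s₂) >>= λ sh₂ →
      both-light n₁ sh₁ sh₂ >>= λ { (l₁ , l₂) → after-two l₁ l₂ (ends (z≼b s₂)) }
      where
      open Step
      a≺y₁ = y≺z s₁
      s₂ : Step a b (z s₁)
      s₂ = next-step b-act y₁≺b (cut s₁)
      a≺y₂ = <-trans a≺y₁ (y≺z s₂)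
      n₁ : FaceNbrs a (z s₁) (z s₂)
      n₁ = face-nbrs closed a≺y₁ y₁≺b cut-left (cut s₂) a≺y₁ (y≺z s₂)
      left : ∀ (l : Light a (z s₁)) → InsideNbrs a b (z s₁ ∷ ears l)
      left l = left-nbrs a≺b (cut s₁) a≺y₁ (inside-nbrs (ears-inside l))

      after-two : Light a (z s₁) → Light (z s₁) (z s₂) → z s₂ ≡ b ⊎ z s₂ ≺ b → Reducible ⊎ Face a b
      after-two l₁ l₂ (inj₁ eq) = inj₂ (two
        (record { left = l₁ ; right = r ; active = active s₁ ; a-nbrs = left l₁
                ; x-nbrs = light-nbrs (λ {R} {R′} → subst (FaceNbrs a (z s₁)) eq n₁ {R} {R′}) l₁ r
                ; b-nbrs = right-nbrs a≺b (cut s₁) y₁≺b (inside-nbrs (inside-swap (ears-inside r))) })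
        (inside-join a≺y₁ y₁≺b (ears-inside l₁) (ears-inside r)))
        where
        r : Light (z s₁) b
        r = subst (Light (z s₁)) eq l₂
      after-two l₁ l₂ (inj₂ y₂≺b) =
        shape (active s₂) (active s₃) (<⇒≤ a≺y₂) (y≺z s₃) (z≼b s₃) (inj₁ a≺y₂) (span s₃) >>= λ sh₃ →
        both-light n₂ (inj₁ l₂) sh₃ >>= λ { (_ , l₃) →
        middle-empty n₁ n₂ l₁ l₂ l₃ >>= λ i₂ → after-three i₂ l₃ (ends (z≼b s₃)) }
        where
        s₃ : Step a b (z s₂)
        s₃ = next-step b-act y₂≺b (cut s₂)
        a≺y₃ = <-trans a≺y₂ (y≺z s₃)
        n₂ : FaceNbrs (z s₁) (z s₂) (z s₃)
        n₂ = face-nbrs closed a≺y₂ y₂≺b (cut s₁) (cut s₃) (y≺z s₂) (y≺z s₃)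

        after-three : Inside (z s₁) (z s₂) [] → Light (z s₂) (z s₃) → z s₃ ≡ b ⊎ z s₃ ≺ b → Reducible ⊎ Face a b
        after-three i₂ l₃ (inj₁ eq) = inj₂ (three
          (record { left = l₁ ; right = r ; x-active = active s₁ ; y-active = active s₂
                  ; x-nbrs = λ {u} xu → subst (λ E → u ∈ a ∷ z s₂ ∷ E) (++-identityʳ (ears l₁)) (light-nbrs n₁ l₁ (empty i₂) xu)
                  ; y-nbrs = light-nbrs (λ {R} {R′} → subst (FaceNbrs (z s₁) (z s₂)) eq n₂ {R} {R′}) (empty i₂) r ; a-nbrs = left l₁
                  ; b-nbrs = right-nbrs a≺b (cut s₂) y₂≺b (inside-nbrs (inside-swap (ears-inside r))) })
          (inside-join a≺y₁ y₁≺b (ears-inside l₁) (inside-join (y≺z s₂) y₂≺b i₂ (ears-inside r))))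
          where
          r : Light (z s₂) b
          r = subst (Light (z s₂)) eq l₃
        -- The fourth step may or may not reach `b`: once the third side is known to be empty as
        -- well, the second vertex of the walk has two empty sides and is reducible.
        after-three i₂ l₃ (inj₂ y₃≺b) =
          shape (active s₃) (active s₄) (<⇒≤ a≺y₃) (y≺z s₄) (z≼b s₄) (inj₁ a≺y₃) (span s₄) >>= λ sh₄ →
          both-light n₃ (inj₁ l₃) sh₄ >>= λ { (_ , l₄) →
          middle-empty n₂ n₃ (empty i₂) l₃ l₄ >>= λ i₃ →
          inj₁ (degree-two-run (active s₂) n₁ n₂ n₃ l₁ i₂ i₃ l₄) }
          where
          s₄ : Step a b (z s₃)
          s₄ = next-step b-act y₃≺b (cut s₃)
          n₃ : FaceNbrs (z s₂) (z s₃) (z s₄)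
          n₃ = face-nbrs closed a≺y₃ y₃≺b (cut s₂) (cut s₄) (y≺z s₃) (y≺z s₄)

  -- Induction on the length of the interval

  mutual
    face : ∀ m {a b} → pos b ≤ pos a + m → a ≺ b → Active a ≡ true → Active b ≡ true → Closed a b → Reducible ⊎ Face a b
    face zero {a} len a≺b a-act b-act closed = ⊥-elim (<⇒≱ a≺b (≤-trans len (≤-reflexive (+-identityʳ (pos a)))))
    face (suc m) {a} {b} len a≺b a-act b-act closed
      with any? (λ w → (Active w Bool.≟ true) ×-dec (pos a <? pos w) ×-dec (pos w <? pos b))
    ... | no none = inj₂ (void inside)
      where
      inside : Inside a b []
      inside act (inj₁ (a≺u , u≺b)) = ⊥-elim (none (_ , act , a≺u , u≺b))
      inside act (inj₂ (b≺u , u≺a)) = ⊥-elim (<-asym a≺b (<-trans b≺u u≺a))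
    ... | yes (w , w-act , a≺w , w≺b) = walk a≺b b-act closed sub a-act w-act a≺w w≺b
      where
      len′ : pos b ≤ suc (pos a + m)
      len′ = ≤-trans len (≤-reflexive (+-suc (pos a) m))
      sub : SidesShaped a b
      sub y-act z-act a≼y y≺z z≼b (inj₁ a≺y) = span-shape m (≤-trans z≼b (≤-trans len′ (+-monoˡ-≤ m a≺y))) y≺z y-act z-act
      sub y-act z-act a≼y y≺z z≼b (inj₂ z≺b) = span-shape m (≤-trans (≤-pred (≤-trans z≺b len′)) (+-monoˡ-≤ m a≼y)) y≺z y-act z-act

    span-shape : ∀ m {a b} → pos b ≤ pos a + m → a ≺ b → Active a ≡ true → Active b ≡ true → Span a b → Reducible ⊎ Shape a b
    span-shape m len a≺b a-act b-act (inj₂ i)  = inj₂ (inj₁ (empty i))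
    span-shape m len a≺b a-act b-act (inj₁ ab) =
      [ inj₁ , chord-shape ab ]′ (face m len a≺b a-act b-act (chord-closed ab))

  -- The outermost face

  reducible-tiny : ∀ {v u w} → Active v ≡ true → Nbrs v (u ∷ w ∷ []) → ∀ L → length L ≤ 6 →
                   (∀ {z} → Active z ≡ true → z ≢ v → z ∈ L) → Reducible
  reducible-tiny {v} act nv L len all = record
    { active = act ; nbrs = nv ; small = ≤-trans (square-list v L λ z≢v near → all (near-active near) z≢v) (≤-trans len 6≤K) }
    where
    near-active : ∀ {z} → Near G v z → Active z ≡ true
    near-active (inj₁ vz)           = edge-active (~-sym vz)
    near-active (inj₂ (_ , _ , yz)) = edge-active (~-sym yz)

  -- No edge ab is available here, so `chord-shape` does not apply. But everything active lies on
  -- the face or is an ear, hence there are at most six active vertices, and any one of them with at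
  -- most two neighbours will do.
  face-reducible : ∀ {a b} → Active a ≡ true →
                   (∀ {L} → Inside a b L → ∀ {u} → Active u ≡ true → u ∈ a ∷ b ∷ L) → Face a b → Reducible
  face-reducible {a} {b} a-act whole (void i) = reducible-tiny a-act nbrs (b ∷ []) (s≤s z≤n) all
    where
    all : ∀ {u} → Active u ≡ true → u ≢ a → u ∈ b ∷ []
    all act u≢a with whole i act
    ... | #0 = ⊥-elim (u≢a refl)
    ... | #1 = #0
    nbrs : Nbrs a (b ∷ b ∷ [])
    nbrs au = there (all (edge-active (~-sym au)) (adj⇒≢ G au ∘ ≡-sym))
  face-reducible {a} {b} a-act whole (two t@record { left = empty _ ; right = empty _ } i) =
    reducible-tiny (Two.active t) (Two.x-nbrs t) (a ∷ b ∷ []) (s≤s (s≤s z≤n)) all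
    where
    all : ∀ {u} → Active u ≡ true → u ≢ Two.x t → u ∈ a ∷ b ∷ []
    all act u≢x with whole i act
    ... | #0 = #0
    ... | #1 = #1
    ... | #2 = ⊥-elim (u≢x refl)
  face-reducible {a} {b} a-act whole (two t@record { left = empty _ ; right = ear v v-act _ nv _ } i) =
    reducible-tiny v-act nv (a ∷ b ∷ Two.x t ∷ []) (s≤s (s≤s (s≤s z≤n))) all
    where
    all : ∀ {u} → Active u ≡ true → u ≢ v → u ∈ a ∷ b ∷ Two.x t ∷ []
    all act u≢v with whole i act
    ... | #0 = #0
    ... | #1 = #1
    ... | #2 = #2
    ... | #3 = ⊥-elim (u≢v refl)
  face-reducible {a} {b} a-act whole (two t@record { left = ear v v-act _ nv _ ; right = r } i) =
    reducible-tiny v-act nv (a ∷ b ∷ Two.x t ∷ ears r) (s≤s (s≤s (s≤s (≤-trans (length-ears r) (s≤s z≤n))))) all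
    where
    all : ∀ {u} → Active u ≡ true → u ≢ v → u ∈ a ∷ b ∷ Two.x t ∷ ears r
    all act u≢v with whole i act
    ... | #0 = #0
    ... | #1 = #1
    ... | #2 = #2
    ... | #3 = ⊥-elim (u≢v refl)
    ... | there (there (there (there p))) = there (there (there p))
  face-reducible {a} {b} a-act whole (three t@record { left = empty _ ; right = empty _ } i) =
    reducible-tiny (Three.x-active t) (Three.x-nbrs t) (a ∷ b ∷ Three.y t ∷ []) (s≤s (s≤s (s≤s z≤n))) all
    where
    all : ∀ {u} → Active u ≡ true → u ≢ Three.x t → u ∈ a ∷ b ∷ Three.y t ∷ []
    all act u≢x with whole i act
    ... | #0 = #0
    ... | #1 = #1
    ... | #2 = ⊥-elim (u≢x refl)
    ... | #3 = #2
  face-reducible {a} {b} a-act whole (three t@record { left = empty _ ; right = ear v v-act _ nv _ } i) =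
    reducible-tiny v-act nv (a ∷ b ∷ Three.x t ∷ Three.y t ∷ []) (s≤s (s≤s (s≤s (s≤s z≤n)))) all
    where
    all : ∀ {u} → Active u ≡ true → u ≢ v → u ∈ a ∷ b ∷ Three.x t ∷ Three.y t ∷ []
    all act u≢v with whole i act
    ... | #0 = #0
    ... | #1 = #1
    ... | #2 = #2
    ... | #3 = #3
    ... | #4 = ⊥-elim (u≢v refl)
  face-reducible {a} {b} a-act whole (three t@record { left = ear v v-act _ nv _ ; right = r } i) =
    reducible-tiny v-act nv (a ∷ b ∷ Three.x t ∷ Three.y t ∷ ears r) (s≤s (s≤s (s≤s (s≤s (≤-trans (length-ears r) (s≤s z≤n)))))) all
    where
    all : ∀ {u} → Active u ≡ true → u ≢ v → u ∈ a ∷ b ∷ Three.x t ∷ Three.y t ∷ ears r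
    all act u≢v with whole i act
    ... | #0 = #0
    ... | #1 = #1
    ... | #2 = #2
    ... | #3 = ⊥-elim (u≢v refl)
    ... | there (there (there (there p))) = there (there (there p))

  exists-reducible : ∀ {v} → Active v ≡ true → Reducible
  exists-reducible {v} v-act
    with extremal _≼_ (λ x z → ≤-total (pos x) (pos z)) ≤-trans (λ x → Active x Bool.≟ true)
       | extremal (λ x z → z ≼ x) (λ x z → ≤-total (pos z) (pos x)) (λ p q → ≤-trans q p) (λ x → Active x Bool.≟ true)
  ... | inj₁ none | _ = ⊥-elim (none v v-act)
  ... | _ | inj₁ none = ⊥-elim (none v v-act)
  ... | inj₂ (b , b-act , top) | inj₂ (a , a-act , bottom) with m≤n⇒m<n∨m≡n (bottom b b-act)
  -- A single active vertex is isolated; `a` merely fills the two neighbour slots.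
  ...   | inj₂ a≡b = reducible-tiny {v = a} {a} {a} a-act (⊥-elim ∘ isolated) [] z≤n (λ act z≢a → ⊥-elim (z≢a (unique act)))
    where
    unique : ∀ {z} → Active z ≡ true → z ≡ a
    unique {z} act = pos-injective (≤-antisym (≤-trans (top z act) (≤-reflexive (≡-sym a≡b))) (bottom z act))
    isolated : ∀ {z} → ¬ (a ~ z)
    isolated az = adj⇒≢ G az (≡-sym (unique (edge-active (~-sym az))))
  ...   | inj₁ a≺b = [ id , face-reducible a-act whole ]′ (face (pos b) (m≤n+m (pos b) (pos a)) a≺b a-act b-act closed)
    where
    closed : Closed a b
    closed xz _ _ = bottom _ (edge-active (~-sym xz)) , top _ (edge-active (~-sym xz))
    whole : ∀ {L} → Inside a b L → ∀ {u} → Active u ≡ true → u ∈ a ∷ b ∷ L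
    whole i {u} act with m≤n⇒m<n∨m≡n (bottom u act) | m≤n⇒m<n∨m≡n (top u act)
    ... | inj₂ a≡u | _        = here (≡-sym (pos-injective a≡u))
    ... | inj₁ a≺u | inj₂ u≡b = there (here (pos-injective u≡b))
    ... | inj₁ a≺u | inj₁ u≺b = there (there (i act (inj₁ (a≺u , u≺b))))

-- Elimination

does⁻ : ∀ {P : Set} (p? : Dec P) → does p? ≡ true → P
does⁻ (yes p) _ = p

-- Deleting v and joining its neighbours keeps all the other adjacencies of the square.
Joined : ∀ {n} → Graph n → Fin n → Fin n → Fin n → Set
Joined G v x y = x ≢ v × y ≢ v × x ≢ y × (adj G x y ≡ true ⊎ (adj G x v ≡ true × adj G v y ≡ true))

joined? : ∀ {n} (G : Graph n) v x y → Dec (Joined G v x y)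
joined? G v x y = ¬? (x ≟ v) ×-dec ¬? (y ≟ v) ×-dec ¬? (x ≟ y) ×-dec
  ((adj G x y Bool.≟ true) ⊎-dec ((adj G x v Bool.≟ true) ×-dec (adj G v y Bool.≟ true)))

joined-sym : ∀ {n} (G : Graph n) {v x y} → Joined G v x y → Joined G v y x
joined-sym G {v} {x} {y} (x≢v , y≢v , x≢y , e) =
  y≢v , x≢v , x≢y ∘ ≡-sym ,
  Sum.map (trans (sym G y x)) (λ (xv , vy) → trans (sym G y v) vy , trans (sym G v x) xv) e

-- The vertex `v` stays as an isolated vertex, so the vertex type and the positions do not change.
suppress : ∀ {n} → Graph n → Fin n → Graph n
suppress G v = record
  { adj    = λ x y → does (joined? G v x y)
  ; sym    = λ x y → does-⇔ (mk⇔ (joined-sym G) (joined-sym G)) (joined? G v x y) (joined? G v y x)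
  ; irrefl = λ x → dec-false (joined? G v x x) λ (_ , _ , x≢x , _) → x≢x refl }

suppress⁻ : ∀ {n} (G : Graph n) {v x y} → adj (suppress G v) x y ≡ true → Joined G v x y
suppress⁻ G {v} {x} {y} = does⁻ (joined? G v x y)

suppress⁺ : ∀ {n} (G : Graph n) {v x y} → Joined G v x y → adj (suppress G v) x y ≡ true
suppress⁺ G {v} {x} {y} = dec-true (joined? G v x y)

suppress-square : ∀ {n} (G : Graph n) {v x y} → x ≢ v → y ≢ v →
                  square G x y ≡ true → square (suppress G v) x y ≡ true
suppress-square G {v} {x} {y} x≢v y≢v xy with square⁻ G xy
... | x≢y , inj₁ e = square⁺ (suppress G v) x≢y (inj₁ (suppress⁺ G (x≢v , y≢v , x≢y , inj₁ e)))
... | x≢y , inj₂ (w , xw , wy) with w ≟ v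
...   | yes refl = square⁺ (suppress G v) x≢y (inj₁ (suppress⁺ G (x≢v , y≢v , x≢y , inj₂ (xw , wy))))
...   | no w≢v   = square⁺ (suppress G v) x≢y (inj₂ (w ,
          suppress⁺ G (x≢v , w≢v , adj⇒≢ G xw , inj₁ xw) , suppress⁺ G (w≢v , y≢v , adj⇒≢ G wy , inj₁ wy)))

AtMostTwoNbrs : ∀ {n} → Graph n → Fin n → Set
AtMostTwoNbrs G v = ∃ λ u → ∃ λ w → ∀ {x} → adj G v x ≡ true → x ∈ u ∷ w ∷ []

-- A neighbour of `v` loses `v` and gains at most the other neighbour `o` of `v`; the other vertices
-- gain nothing.
suppress-deg : ∀ {n} (G : Graph n) v → AtMostTwoNbrs G v → ∀ x → deg (suppress G v) x ≤ deg G x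
suppress-deg {n} G v (u , w , nv) x = by-adjacency (adj G x v) refl
  where
  other : adj G x v ≡ true → ∃ λ o → ∀ {y} → x ≢ y → adj G v y ≡ true → y ∈ o ∷ []
  other xv with nv (trans (sym G v x) xv)
  ... | #0 = w , λ x≢y vy → drop-left x≢y (nv vy)
    where
    drop-left : ∀ {y} → u ≢ y → y ∈ u ∷ w ∷ [] → y ∈ w ∷ []
    drop-left u≢y #0 = contradiction refl u≢y
    drop-left u≢y #1 = #0
  ... | #1 = u , λ x≢y vy → drop-right x≢y (nv vy)
    where
    drop-right : ∀ {y} → w ≢ y → y ∈ u ∷ w ∷ [] → y ∈ u ∷ []
    drop-right w≢y #0 = #0
    drop-right w≢y #1 = contradiction refl w≢y
  by-adjacency : ∀ t → adj G x v ≡ t → deg (suppress G v) x ≤ deg G x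
  by-adjacency false xv = count-mono {S = adj (suppress G v) x} {S′ = adj G x} unchanged
    where
    unchanged : ∀ y → adj (suppress G v) x y ≡ true → adj G x y ≡ true
    unchanged y e with suppress⁻ G e
    ... | _ , _ , _ , inj₁ xy = xy
    ... | _ , _ , _ , inj₂ (xv′ , _) with trans (≡-sym xv) xv′
    ...   | ()
  by-adjacency true xv with other xv
  ... | o , only = ≤-trans (count-list {S = adj (suppress G v) x} (o ∷ []) cover) (count-─ (adj G x) v xv)
    where
    cover : ∀ y → adj (suppress G v) x y ≡ true → y ∈ o ∷ [] ⊎ (adj G x ─ v) y ≡ true
    cover y e with suppress⁻ G e
    ... | _ , y≢v , x≢y , inj₁ xy       = inj₂ (─⁺ (adj G x) xy y≢v)
    ... | _ , y≢v , x≢y , inj₂ (_ , vy) = inj₁ (only x≢y vy)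

-- The new edge replaces a path through `v`. A chord crossing it does not end at `v`, so it
-- separates `v` from one end of the path and already crosses one of the two old edges.
suppress-non-crossing : ∀ {n} (G : Graph n) (pos : Fin n → ℕ) → (∀ {x y} → pos x ≡ pos y → x ≡ y) →
  NonCrossing G pos → ∀ v → AtMostTwoNbrs G v → NonCrossing (suppress G v) pos
suppress-non-crossing G pos pos-injective nc v (u , w , nv) a b c d e f (a<c , c<b , b<d)
  with suppress⁻ G e | suppress⁻ G f
... | _ , _ , _ , inj₁ ab | _ , _ , _ , inj₁ cd = nc a b c d ab cd (a<c , c<b , b<d)
... | a≢v , b≢v , _ , inj₁ ab | _ , _ , _ , inj₂ (cv , vd) with <-cmp (pos v) (pos a) | <-cmp (pos v) (pos b)
...   | tri< v<a _ _ | _            = nc v c a b (trans (sym G v c) cv) ab (v<a , a<c , c<b)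
...   | tri≈ _ v≡a _ | _            = a≢v (≡-sym (pos-injective v≡a))
...   | tri> _ _ a<v | tri< v<b _ _ = nc a b v d ab vd (a<v , v<b , b<d)
...   | tri> _ _ a<v | tri≈ _ v≡b _ = b≢v (≡-sym (pos-injective v≡b))
...   | tri> _ _ a<v | tri> _ _ b<v = nc a b c v ab cv (a<c , c<b , b<v)
suppress-non-crossing G pos pos-injective nc v (u , w , nv) a b c d e f (a<c , c<b , b<d)
    | _ , _ , _ , inj₂ (av , vb) | c≢v , d≢v , _ , inj₁ cd with <-cmp (pos v) (pos c) | <-cmp (pos v) (pos d)
...   | tri< v<c _ _ | _            = nc v b c d vb cd (v<c , c<b , b<d)
...   | tri≈ _ v≡c _ | _            = c≢v (≡-sym (pos-injective v≡c))
...   | tri> _ _ c<v | tri< v<d _ _ = nc a v c d av cd (a<c , c<v , v<d)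
...   | tri> _ _ c<v | tri≈ _ v≡d _ = d≢v (≡-sym (pos-injective v≡d))
...   | tri> _ _ c<v | tri> _ _ d<v = nc c d b v cd (trans (sym G b v) vb) (c<b , b<d , d<v)
-- Two new edges cannot cross: all their ends are among the two neighbours of `v`, while `a`, `c`
-- and `b` would be distinct.
suppress-non-crossing G pos pos-injective nc v (u , w , nv) a b c d e f (a<c , c<b , b<d)
    | _ , _ , _ , inj₂ (av , vb) | _ , _ , _ , inj₂ (cv , _)
  with nv (trans (sym G v a) av) | nv vb | nv (trans (sym G v c) cv)
...   | #0 | #0 | _  = <-irrefl refl (<-trans a<c c<b)
...   | #1 | #1 | _  = <-irrefl refl (<-trans a<c c<b)
...   | #0 | #1 | #0 = <-irrefl refl a<c
...   | #0 | #1 | #1 = <-irrefl refl c<b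
...   | #1 | #0 | #0 = <-irrefl refl c<b
...   | #1 | #0 | #1 = <-irrefl refl a<c

-- `S` stays fixed while `G` and the set `U` of remaining vertices change. Only vertices outside `S`
-- are eliminated, so `S` stays inside `U`, and the induction is on the size of `U`.
small-degIn : ∀ {n} (pos : Fin n → ℕ) → (∀ {x y} → pos x ≡ pos y → x ≡ y) →
  ∀ {Δ K} → Δ ≤ K → 6 ≤ K → suc Δ ≤ K ⊎ 7 ≤ K → (S : Subset n) → ∀ {s} → S s ≡ true →
  ∀ m (G : Graph n) → NonCrossing G pos → (∀ v → deg G v ≤ Δ) →
  (U : Subset n) → (∀ {x y} → adj G x y ≡ true → U x ≡ true) → (∀ {x} → S x ≡ true → U x ≡ true) → count U ≤ m →
  ∃ λ v → S v ≡ true × degIn (square G) S v ≤ K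
small-degIn pos inj Δ≤K 6≤K slack S {s} Ss zero G nc deg≤ U edge S⊆U |U|≤0 =
  ⊥-elim (<⇒≱ (s≤s z≤n) (≤-trans (count-─ U s (S⊆U Ss)) |U|≤0))
small-degIn {n} pos inj {K = K} Δ≤K 6≤K slack S {s} Ss (suc m) G nc deg≤ U edge S⊆U |U|≤m = result (S v) refl
  where
  open Reducibility G pos inj nc U edge deg≤ Δ≤K 6≤K slack
  open Reducible (exists-reducible (S⊆U Ss)) renaming (vertex to v)

  two-nbrs : AtMostTwoNbrs G v
  two-nbrs = nbr₁ , nbr₂ , nbrs

  S⇒≢v : S v ≡ false → ∀ {x} → S x ≡ true → x ≢ v
  S⇒≢v v∉S Sx refl with trans (≡-sym Sx) v∉S
  ... | ()

  result : ∀ t → S v ≡ t → ∃ λ x → S x ≡ true × degIn (square G) S x ≤ K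
  result true  Sv = v , Sv , ≤-trans (count-mono {S = λ u → S u ∧ square G v u} λ u e → proj₂ (∧-true⁻ {S u} e)) small
  result false v∉S with small-degIn pos inj Δ≤K 6≤K slack S Ss m (suppress G v)
    (suppress-non-crossing G pos inj nc v two-nbrs) (λ x → ≤-trans (suppress-deg G v two-nbrs x) (deg≤ x))
    (U ─ v) (λ {x} {y} → edge′ {x} {y}) (λ Sx → ─⁺ U (S⊆U Sx) (S⇒≢v v∉S Sx)) (≤-pred (≤-trans (count-─ U v active) |U|≤m))
    where
    edge′ : ∀ {x y} → adj (suppress G v) x y ≡ true → (U ─ v) x ≡ true
    edge′ {x} {y} e with suppress⁻ G {v} {x} {y} e
    ... | x≢v , _ , _ , inj₁ xy       = ─⁺ U (edge xy) x≢v
    ... | x≢v , _ , _ , inj₂ (xv , _) = ─⁺ U (edge xv) x≢v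
  ... | x , Sx , dx≤K = x , Sx , ≤-trans (count-mono {S = λ y → S y ∧ square G x y} mono) dx≤K
    where
    mono : ∀ y → S y ∧ square G x y ≡ true → S y ∧ square (suppress G v) x y ≡ true
    mono y e with ∧-true⁻ {S y} e
    ... | Sy , xy = cong₂ _∧_ Sy (suppress-square G (S⇒≢v v∉S Sx) (S⇒≢v v∉S Sy) xy)

ind-square≤ : ∀ {n} (G : Graph n) {Δ K} → Outerplanar G → (∀ v → deg G v ≤ Δ) →
              Δ ≤ K → 6 ≤ K → suc Δ ≤ K ⊎ 7 ≤ K → ind (square G) ≤ K
ind-square≤ {n} G (p , p-injective , nc) deg≤ Δ≤K 6≤K slack = ind≤ {A = square G} λ S s Ss →
  small-degIn (toℕ ∘ p) (p-injective ∘ toℕ-injective) Δ≤K 6≤K slack S Ss (count {n} (λ _ → true)) G nc deg≤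
    (λ _ → true) (λ _ → refl) (λ _ → refl) ≤-refl

theorem3p1 : ∀ {n} (G : Graph n) (Δ : ℕ) → Outerplanar G → HasMaxDegree G Δ → 5 ≤ Δ →
    (ind (square G) ≤ suc Δ) × (7 ≤ Δ → ind (square G) ≡ Δ)
theorem3p1 G Δ outer (deg≤ , v , deg-v) 5≤Δ =
  -- K = Δ + 1, which is at least 6 because Δ ≥ 5.
  ind-square≤ G outer deg≤ (n≤1+n Δ) (s≤s 5≤Δ) (inj₁ ≤-refl) ,
  -- K = Δ for the upper bound; the lower bound comes from the closed neighbourhood of a vertex of
  -- degree Δ.
  λ 7≤Δ → ≤-antisym (ind-square≤ G outer deg≤ ≤-refl (≤-trans (n≤1+n 6) 7≤Δ) (inj₂ 7≤Δ))
                    (subst (_≤ ind (square G)) deg-v (deg≤ind-square G v))
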